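{- There exists a $2$-extendible system that is not a $2$-growth system.
   Context: An independence system $(S,\mathcal{I})$ is a finite set $S$ with a nonempty downward-closed family $\mathcal{I}\subseteq2^S$ of independent sets. A basis of $X\subseteq S$ is an inclusion-wise maximal independent subset of $X$. $k$-extendible: for every $A\subseteq B\in\mathcal{I}$ and $e\in S\setminus B$ with $A\cup\{e\}\in\mathcal{I}$, there is $Z\subseteq B\setminus A$ with $|Z|\le k$ and $(B\cup\{e\})\setminus Z\in\mathcal{I}$. $k$-growth: for all $X\subseteq S$ and all $I\in\mathcal{I}$ there is a partition $(Q,Z)$ of $I\setminus X$ with $|Z|\le k|X\setminus I|$ such that $P\cup Q\in\mathcal{I}$ for every basis $P$ of $X$. -}

module Defs where

open import Data.Fin using (Fin)
open import Data.Fin.Subset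
  using (Subset; _∉_; _⊆_; _∪_; _∩_; _─_; ⁅_⁆; ∣_∣; Empty)
open import Data.Nat using (ℕ; _≤_; _*_)
open import Data.Product using (∃; ∃₂; _×_)
open import Relation.Binary.PropositionalEquality using (_≡_)
open import Relation.Unary using (Pred; Decidable; Satisfiable)
open import Level using (0ℓ)

-- The finite ground set is Fin n.  Decidability of independence makes the
-- predicate a family of subsets in the classical sense (an element of 2^2^S).
record IndependenceSystem (n : ℕ) : Set₁ where
  field
    Independent  : Pred (Subset n) 0ℓ
    independent? : Decidable Independent
    nonempty     : Satisfiable Independent
    downClosed   : ∀ {I J} → I ⊆ J → Independent J → Independent I

  record IsBasis (X P : Subset n) : Set where
    field
      P⊆X         : P ⊆ X
      independent : Independent P
      maximal     : ∀ Y → Y ⊆ X → Independent Y → P ⊆ Y → Y ≡ P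

-- The parts of a partition (Q , Z) may be empty.
record IsPartition {n : ℕ} (Q Z Y : Subset n) : Set where
  field
    disjoint : Empty (Q ∩ Z)
    covers   : Q ∪ Z ≡ Y

module _ {n : ℕ} (k : ℕ) (𝓢 : IndependenceSystem n) where
  open IndependenceSystem 𝓢

  Extendible : Set
  Extendible =
    ∀ (A B : Subset n) → A ⊆ B → Independent B →
    ∀ (e : Fin n) → e ∉ B → Independent (A ∪ ⁅ e ⁆) →
    ∃ λ (Z : Subset n) →
      Z ⊆ B ─ A × ∣ Z ∣ ≤ k × Independent ((B ∪ ⁅ e ⁆) ─ Z)

  Growth : Set
  Growth =
    ∀ (X I : Subset n) → Independent I →
    ∃₂ λ (Q Z : Subset n) →
      IsPartition Q Z (I ─ X) ×
      ∣ Z ∣ ≤ k * ∣ X ─ I ∣ ×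
      (∀ (P : Subset n) → IsBasis X P → Independent (P ∪ Q))

-- A system all of whose bases omit at most k elements is k-extendible: if A ∪ {e} lies in the
-- basis ∁ U, then deleting U ∩ (B ─ A) from B ∪ {e} leaves a subset of ∁ U.
-- For the counterexample take the ground set {c₀, c₁, c₂, d₀, d₁, d₂, e} and the bases
-- ∁ {e}, ∁ {cᵢ , cⱼ} and ∁ {cᵢ , dᵢ}.  With X = {c₀, c₁, c₂, e} and I = ∁ {e}, each X ─ {cᵢ} is
-- a basis of X that becomes dependent when dᵢ is added, so Z must contain all three dᵢ,
-- although |X ─ I| = 1 permits only two elements.
module Submission where

open import Defs
open import Data.Product using (∃; Σ-syntax; _×_)
open import Relation.Nullary using (¬_)

open import Data.Fin using (Fin; #_; _↑ˡ_; _↑ʳ_)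
open import Data.Fin.Properties using (all?; _≟_) renaming (any? to ∃?)
open import Data.Fin.Subset using (Subset; ⊥; ∁; ⁅_⁆; _∪_; _∩_; _─_; _-_; _∈_; _∉_; _⊆_; ∣_∣; inside; outside)
open import Data.Fin.Subset.Properties
open import Data.List using (List; _∷_; [])
open import Data.List.Membership.Propositional using (find; lose)
open import Data.List.Relation.Unary.All as All using (All)
open import Data.List.Relation.Unary.Any as Any using (Any; here; any?)
open import Data.Nat using (_≤_; _≤?_)
open import Data.Nat.Properties using (≤-trans)
open import Data.Product using (_,_)
open import Data.Sum using (inj₁; inj₂)
open import Data.Vec using (_∷_; there)
open import Relation.Binary.PropositionalEquality using (refl; sym; subst)
open import Relation.Nullary using (yes; no; ¬?; _→-dec_; contradiction)
open import Relation.Nullary.Decidable using (from-yes; from-no)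

x∈p─q⇒x∉q : ∀ {n} (p q : Subset n) {x} → x ∈ p ─ q → x ∉ q
x∈p─q⇒x∉q (_ ∷ p) (inside ∷ q)  (there x∈p─q) (there x∈q) = x∈p─q⇒x∉q p q x∈p─q x∈q
x∈p─q⇒x∉q (_ ∷ p) (outside ∷ q) (there x∈p─q) (there x∈q) = x∈p─q⇒x∉q p q x∈p─q x∈q

-- The system is given by complements of its candidate bases. Splitting off the first one as `U`
-- rules out the empty list, under which even `⊥` would be dependent.
avoiding : ∀ {n} → Subset n → List (Subset n) → IndependenceSystem n
avoiding U Us = record
  { Independent  = λ I → Any (λ V → I ⊆ ∁ V) (U ∷ Us)
  ; independent? = λ I → any? (λ V → I ⊆? ∁ V) (U ∷ Us)
  ; nonempty     = ⊥ , here ⊥⊆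
  ; downClosed   = λ I⊆J → Any.map (⊆-trans I⊆J)
  }

avoiding-extendible : ∀ {n k} {U : Subset n} {Us} →
  All (λ V → ∣ V ∣ ≤ k) (U ∷ Us) → Extendible k (avoiding U Us)
avoiding-extendible small A B _ _ e _ A∪e-indep with find A∪e-indep
... | V , V∈Us , A∪e⊆∁V =
  Z , p∩q⊆q V (B ─ A) ,
  ≤-trans (∣p∩q∣≤∣p∣ V (B ─ A)) (All.lookup small V∈Us) ,
  lose V∈Us λ x∈ → x∉p⇒x∈∁p λ x∈V → x∈p─q⇒x∉q (B ∪ ⁅ e ⁆) Z x∈
    (x∈p∩q⁺ (x∈V , V∩[B∪e]⊆B─A x∈V (p─q⊆p (B ∪ ⁅ e ⁆) Z x∈)))
  where
  Z = V ∩ (B ─ A)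

  -- `V` misses both `A` and `e`, so whatever it meets in `B ∪ ⁅ e ⁆` may be deleted.
  V∩[B∪e]⊆B─A : ∀ {x} → x ∈ V → x ∈ B ∪ ⁅ e ⁆ → x ∈ B ─ A
  V∩[B∪e]⊆B─A x∈V x∈B∪e with x∈p∪q⁻ B ⁅ e ⁆ x∈B∪e
  ... | inj₁ x∈B = x∈p∧x∉q⇒x∈p─q x∈B λ x∈A →
    x∈∁p⇒x∉p (A∪e⊆∁V (p⊆p∪q ⁅ e ⁆ x∈A)) x∈V
  ... | inj₂ x∈e = contradiction x∈V (x∈∁p⇒x∉p (A∪e⊆∁V (q⊆p∪q A ⁅ e ⁆ x∈e)))

module _ {n} (𝓢 : IndependenceSystem n) where
  open IndependenceSystem 𝓢

  -- A set between `X - x` and `X` that contains `x` is all of `X`, hence dependent.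
  dependent-x-isBasis : ∀ {X x} → ¬ Independent X → Independent (X - x) → IsBasis X (X - x)
  dependent-x-isBasis {X} {x} X-dep X-x-indep = record
    { P⊆X         = p─q⊆p X ⁅ x ⁆
    ; independent = X-x-indep
    ; maximal     = λ Y Y⊆X Y-indep X-x⊆Y →
        ⊆-antisym (λ y∈Y → x∈p∧x∉q⇒x∈p─q (Y⊆X y∈Y) λ y∈x →
          X-dep (downClosed (X⊆Y X-x⊆Y (subst (_∈ Y) (x∈⁅y⁆⇒x≡y x y∈x) y∈Y)) Y-indep)) X-x⊆Y
    }
    where
    X⊆Y : ∀ {Y} → X - x ⊆ Y → x ∈ Y → X ⊆ Y
    X⊆Y {Y} X-x⊆Y x∈Y {z} z∈X with z ∈? ⁅ x ⁆
    ... | yes z∈x = subst (_∈ Y) (sym (x∈⁅y⁆⇒x≡y x z∈x)) x∈Y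
    ... | no  z∉x = X-x⊆Y (x∈p∧x∉q⇒x∈p─q z∈X z∉x)

c d : Fin 3 → Fin 7
c i = i ↑ˡ 4
d i = 3 ↑ʳ (i ↑ˡ 1)

e : Fin 7
e = # 6

cobases : List (Subset 7)
cobases =
  (⁅ c (# 0) ⁆ ∪ ⁅ c (# 1) ⁆) ∷ (⁅ c (# 0) ⁆ ∪ ⁅ c (# 2) ⁆) ∷ (⁅ c (# 1) ⁆ ∪ ⁅ c (# 2) ⁆) ∷
  (⁅ c (# 0) ⁆ ∪ ⁅ d (# 0) ⁆) ∷ (⁅ c (# 1) ⁆ ∪ ⁅ d (# 1) ⁆) ∷ (⁅ c (# 2) ⁆ ∪ ⁅ d (# 2) ⁆) ∷ []

𝓢₇ : IndependenceSystem 7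
𝓢₇ = avoiding ⁅ e ⁆ cobases

open IndependenceSystem 𝓢₇

𝓢₇-extendible : Extendible 2 𝓢₇
𝓢₇-extendible = avoiding-extendible (from-yes (All.all? (λ V → ∣ V ∣ ≤? 2) (⁅ e ⁆ ∷ cobases)))

D X I : Subset 7
D = ⁅ d (# 0) ⁆ ∪ ⁅ d (# 1) ⁆ ∪ ⁅ d (# 2) ⁆
X = ∁ D
I = ∁ ⁅ e ⁆

-- Every cobasis contains `e` or some `c j`, so it meets `X`; but `⁅ c i ⁆ ∪ ⁅ d i ⁆` misses
-- `X - c i`.
X-cᵢ-isBasis : ∀ i → IsBasis X (X - c i)
X-cᵢ-isBasis i = dependent-x-isBasis 𝓢₇ {X} {c i} (from-no (independent? X))
  (from-yes (all? λ j → independent? (X - c j)) i)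

-- The complement consists of `c i` and the two `d j` with `j` other than `i`, and no cobasis fits
-- inside it.
X-cᵢ∪dᵢ-dependent : ∀ i → ¬ Independent ((X - c i) ∪ ⁅ d i ⁆)
X-cᵢ∪dᵢ-dependent = from-yes (all? λ i → ¬? (independent? ((X - c i) ∪ ⁅ d i ⁆)))

𝓢₇-not-growth : ¬ Growth 2 𝓢₇
𝓢₇-not-growth growth with growth X I (from-yes (independent? I))
... | Q , Z , QZ , ∣Z∣≤2 , extends =
  -- Here 3 is `∣ D ∣`, and the growth bound evaluates to 2 because `X ─ I` is `⁅ e ⁆`.
  from-no (3 ≤? 2) (≤-trans (p⊆q⇒∣p∣≤∣q∣ D⊆Z) ∣Z∣≤2)
  where
  dᵢ∈Z : ∀ i → d i ∈ Z
  dᵢ∈Z i with x∈p∪q⁻ Q Z (subst (d i ∈_) (sym (IsPartition.covers QZ))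
                            (from-yes (all? λ j → d j ∈? I ─ X) i))
  ... | inj₂ di∈Z = di∈Z
  ... | inj₁ di∈Q = contradiction
    (downClosed P∪d⊆P∪Q (extends P (X-cᵢ-isBasis i))) (X-cᵢ∪dᵢ-dependent i)
    where
    P = X - c i
    P∪d⊆P∪Q : P ∪ ⁅ d i ⁆ ⊆ P ∪ Q
    P∪d⊆P∪Q x∈ with x∈p∪q⁻ P ⁅ d i ⁆ x∈
    ... | inj₁ x∈P = p⊆p∪q Q x∈P
    ... | inj₂ x∈d = q⊆p∪q P Q (subst (_∈ Q) (sym (x∈⁅y⁆⇒x≡y (d i) x∈d)) di∈Q)

  D⊆Z : D ⊆ Z
  D⊆Z x∈D with from-yes (all? λ x → (x ∈? D) →-dec ∃? (λ i → x ≟ d i)) _ x∈D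
  ... | i , refl = dᵢ∈Z i

theorem11 : ∃ λ n → Σ[ 𝓢 ∈ IndependenceSystem n ] (Extendible 2 𝓢 × ¬ Growth 2 𝓢)
theorem11 = 7 , 𝓢₇ , 𝓢₇-extendible , 𝓢₇-not-growth
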